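{- Let $G$ and $H$ be connected graphs. Then $$2b(G^2)-2 \leq b_{\rm g}(G \circ H) \leq 2b(G^2),$$ where equality in the lower bound requires $H = K_1$ (that is, if $H\neq K_1$ then $b_{\rm g}(G\circ H)\neq 2b(G^2)-2$). Additionally, $$2b(G^2)-3 \leq b_{\rm g}'(G \circ H) \leq 2b(G^2)+1,$$ where once again, if $H \neq K_1$, equality in the lower bound cannot hold.
   Context: All graphs are finite, simple and undirected; connected graphs are nonempty. The burning game on a graph $G$ is played by two players, Burner and Staller, in rounds $t=1,2,3,\dots$. Initially (round $0$) all vertices are unburned. Each round $t\ge 1$ consists of two phases: first, in the spreading phase, every unburned vertex having a burning neighbor starts to burn (fire spreads simultaneously, by distance one, from all burning vertices); then, in the selection phase, if unburned vertices remain, the player whose turn it is chooses one unburned vertex, which starts to burn. Burning vertices stay burning forever. The players alternate: one of them selects in the odd rounds, the other in the even rounds. The game ends in the first round in which all vertices of $G$ are burning (possibly already after the spreading phase of that round). Burner wants to minimize the number of rounds and Staller wants to maximize it. If both play optimally, the number of rounds is denoted $b_{\rm g}(G)$ when Burner makes the first move (selects in round 1), and $b_{\rm g}'(G)$ when Staller makes the first move. The burning number $b(G)$ is the minimum number of rounds needed to burn all vertices of $G$ in the same process when a single agent makes all selections (one vertex per round). The square $G^2$ of $G$ has vertex set $V(G)$, with distinct $u,v$ adjacent iff $d_G(u,v)\le 2$. The corona product $G\circ H$ is obtained from one copy of $G$ and $|V(G)|$ disjoint copies of $H$ by joining the $i$-th vertex of $G$ to every vertex in the $i$-th copy of $H$.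 $K_1$ is the one-vertex graph, and $H=K_1$ is meant up to isomorphism. -}

module Defs where

open import Data.Empty using (⊥)
open import Data.Fin using (Fin)
open import Data.Fin.Properties using (+↔⊎; *↔×; 1↔⊤; inj⇒≟)
open import Data.List using (List; []; _∷_; map; filter; length; tabulate)
open import Data.List.Extrema.Nat using (min; max)
import Data.List.Membership.DecPropositional as DecMembership
open import Data.List.Membership.Propositional using (_∈_; _∉_; lose)
open import Data.List.Membership.Propositional.Properties
  using (∈-tabulate⁺; ∈-filter⁺; ∈-filter⁻)
open import Data.List.Properties using (map-cong-local; length-filter; length-tabulate)
import Data.List.Relation.Unary.All as All
open import Data.List.Relation.Unary.Any using (any?; here; there; satisfied)
open import Data.Nat using (ℕ; zero; suc; _+_; _*_; _≤_; _<_; z≤n; s≤s; s≤s⁻¹)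
open import Data.Nat.Properties using (m≤n⇒m≤1+n; <-≤-trans; anyUpTo?)
open import Data.Product using (∃-syntax; _×_; _,_; proj₂)
open import Data.Product.Function.NonDependent.Propositional using (_×-↔_)
open import Data.Sum using (_⊎_; inj₁; inj₂)
open import Data.Sum.Function.Propositional using (_⊎-↔_)
open import Data.Unit using (⊤)
open import Function using (id; _∘_)
open import Function.Bundles using (_↔_; _⇔_; Inverse)
open import Function.Properties.Inverse using (↔-sym; ↔-trans; ↔⇒↣)
open import Relation.Binary.Definitions
  using (Decidable; DecidableEquality; Symmetric; Irreflexive)
open import Relation.Binary.PropositionalEquality
  using (_≡_; _≢_; refl; sym; cong; cong₂; subst)
open import Relation.Nullary using (¬_; yes; no)
open import Relation.Nullary.Decidable using (map′; ¬?; _×-dec_; _⊎-dec_)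
open import Relation.Nullary.Negation using (contradiction)
import Relation.Unary as U

record Graph : Set₁ where
  field
    V      : Set
    order  : ℕ
    finite : V ↔ Fin order
    Adj    : V → V → Set
    adj?   : Decidable Adj
    symm   : Symmetric Adj
    irrefl : Irreflexive _≡_ Adj

  infix 4 _≟_
  _≟_ : DecidableEquality V
  _≟_ = inj⇒≟ (↔⇒↣ finite)

  vertices : List V
  vertices = tabulate (Inverse.from finite)

  ∈-vertices : ∀ v → v ∈ vertices
  ∈-vertices v = subst (_∈ vertices) (Inverse.strictlyInverseʳ finite v)
                       (∈-tabulate⁺ (Inverse.to finite v))

  data Walk : ℕ → V → V → Set where
    nil  : ∀ {u} → Walk 0 u u
    cons : ∀ {k u v w} → Adj u v → Walk k v w → Walk (suc k) u w

  walk? : ∀ k → Decidable (Walk k)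
  walk? zero    u v = map′ (λ { refl → nil }) (λ { nil → refl }) (u ≟ v)
  walk? (suc k) u v =
    map′ (λ p → let _ , a , q = satisfied {P = λ w → Adj u w × Walk k w v} p in cons a q)
         (λ { (cons a q) → lose (∈-vertices _) (a , q) })
         (any? (λ w → adj? u w ×-dec walk? k w v) vertices)

  -- d(u,v) ≤ k.  The distance is the length of a shortest walk, and need not
  -- be defined when the graph is disconnected.
  Distance≤ : ℕ → V → V → Set
  Distance≤ k u v = ∃[ l ] l ≤ k × Walk l u v

  distance≤? : ∀ k → Decidable (Distance≤ k)
  distance≤? k u v =
    map′ (λ { (l , l<1+k , p) → l , s≤s⁻¹ l<1+k , p })
         (λ { (l , l≤k , p) → l , s≤s l≤k , p })
         (anyUpTo? (λ l → walk? l u v) (suc k))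

  walk-snoc : ∀ {k u v w} → Walk k u v → Adj v w → Walk (suc k) u w
  walk-snoc nil        b = cons b nil
  walk-snoc (cons a p) b = cons a (walk-snoc p b)

  walk-sym : ∀ {k} → Symmetric (Walk k)
  walk-sym nil        = nil
  walk-sym (cons a p) = walk-snoc (walk-sym p) (symm a)

record Connected (G : Graph) : Set where
  open Graph G
  field
    nonempty : V
    joined   : ∀ u v → ∃[ k ] Walk k u v

record _≅_ (G H : Graph) : Set where
  private
    module G = Graph G
    module H = Graph H
  field
    bijection : G.V ↔ H.V
    adjacency : ∀ u v → G.Adj u v ⇔ H.Adj (Inverse.to bijection u) (Inverse.to bijection v)

infix 4 _≅_

K₁ : Graph
K₁ = record
  { V      = ⊤
  ; order  = 1
  ; finite = ↔-sym 1↔⊤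
  ; Adj    = λ _ _ → ⊥
  ; adj?   = λ _ _ → no λ ()
  ; symm   = λ ()
  ; irrefl = λ _ ()
  }

infix 25 _²

_² : Graph → Graph
G ² = record
  { V      = V
  ; order  = order
  ; finite = finite
  ; Adj    = λ u v → u ≢ v × Distance≤ 2 u v
  ; adj?   = λ u v → ¬? (u ≟ v) ×-dec distance≤? 2 u v
  ; symm   = λ { (u≢v , l , l≤2 , p) → u≢v ∘ sym , l , l≤2 , walk-sym p }
  ; irrefl = λ u≡v (u≢v , _) → u≢v u≡v
  }
  where open Graph G

module _ (G H : Graph) where
  private
    module G = Graph G
    module H = Graph H

  -- inj₁ u is the vertex u of G; inj₂ (u , h) is the vertex h of the copy of H
  -- attached to u.
  CoronaV : Set
  CoronaV = G.V ⊎ (G.V × H.V)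

  CoronaAdj : CoronaV → CoronaV → Set
  CoronaAdj (inj₁ u)       (inj₁ v)       = G.Adj u v
  CoronaAdj (inj₁ u)       (inj₂ (v , _)) = u ≡ v
  CoronaAdj (inj₂ (u , _)) (inj₁ v)       = u ≡ v
  CoronaAdj (inj₂ (u , h)) (inj₂ (v , k)) = u ≡ v × H.Adj h k

  coronaAdj? : Decidable CoronaAdj
  coronaAdj? (inj₁ u)       (inj₁ v)       = G.adj? u v
  coronaAdj? (inj₁ u)       (inj₂ (v , _)) = u G.≟ v
  coronaAdj? (inj₂ (u , _)) (inj₁ v)       = u G.≟ v
  coronaAdj? (inj₂ (u , h)) (inj₂ (v , k)) = (u G.≟ v) ×-dec H.adj? h k

  coronaAdj-sym : Symmetric CoronaAdj
  coronaAdj-sym {inj₁ _} {inj₁ _} a         = G.symm a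
  coronaAdj-sym {inj₁ _} {inj₂ _} e         = sym e
  coronaAdj-sym {inj₂ _} {inj₁ _} e         = sym e
  coronaAdj-sym {inj₂ _} {inj₂ _} (e , a)   = sym e , H.symm a

  coronaAdj-irrefl : Irreflexive _≡_ CoronaAdj
  coronaAdj-irrefl {inj₁ _} refl a       = G.irrefl refl a
  coronaAdj-irrefl {inj₂ _} refl (_ , a) = H.irrefl refl a

  corona : Graph
  corona = record
    { V      = CoronaV
    ; order  = G.order + G.order * H.order
    ; finite = ↔-trans (G.finite ⊎-↔ ↔-trans (G.finite ×-↔ H.finite) (↔-sym *↔×)) (↔-sym +↔⊎)
    ; Adj    = CoronaAdj
    ; adj?   = coronaAdj?
    ; symm   = λ {x} {y} → coronaAdj-sym {x} {y}
    ; irrefl = λ {x} {y} → coronaAdj-irrefl {x} {y}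
    }

data Player : Set where
  burner staller : Player

opponent : Player → Player
opponent burner  = staller
opponent staller = burner

best : Player → ℕ → List ℕ → ℕ
best burner  = min
best staller = max

module Burning (G : Graph) where
  open Graph G
  open DecMembership _≟_ using (_∈?_)

  -- A position is a list of the burning vertices; order and repetition are
  -- irrelevant.
  unburned : List V → List V
  unburned S = filter (λ v → ¬? (v ∈? S)) vertices

  spread : List V → List V
  spread S = filter (λ v → (v ∈? S) ⊎-dec any? (adj? v) S) vertices

  -- The number of further rounds from position S when p makes the next
  -- selection, `next` gives the player selecting in the following round, and
  -- both players play optimally.  Play is cut off after n rounds; by
  -- `rounds-stable` this does not matter once n is at least the number of
  -- unburned vertices, which is at most `order` in the empty position.
  rounds      : (Player → Player) → ℕ → Player → List V → ℕ
  afterSpread : (Player → Player) → ℕ → Player → List V → ℕ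

  rounds next zero    p S = 0
  rounds next (suc n) p S with unburned S
  ... | []    = 0
  ... | _ ∷ _ = suc (afterSpread next n p (spread S))

  afterSpread next n p S with unburned S
  ... | []     = 0
  ... | v ∷ vs = best p (after v) (map after vs)
    where
    after : V → ℕ
    after u = rounds next n (next p) (u ∷ S)

  spread-extends : ∀ {v} S → v ∈ S → v ∈ spread S
  spread-extends S v∈S = ∈-filter⁺ _ (∈-vertices _) (inj₁ v∈S)

  private
    length-filter-< : ∀ {P Q : V → Set} (P? : U.Decidable P) (Q? : U.Decidable Q) →
                      (∀ {v} → P v → Q v) → ∀ {u} → Q u → ¬ P u → ∀ xs → u ∈ xs →
                      length (filter P? xs) < length (filter Q? xs)
    length-filter-< P? Q? P⇒Q {u} Qu ¬Pu = go
      where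
      le : ∀ xs → length (filter P? xs) ≤ length (filter Q? xs)
      le [] = z≤n
      le (x ∷ xs) with P? x | Q? x
      ... | yes _ | yes _ = s≤s (le xs)
      ... | yes p | no ¬q = contradiction (P⇒Q p) ¬q
      ... | no _  | yes _ = m≤n⇒m≤1+n (le xs)
      ... | no _  | no _  = le xs

      go : ∀ xs → u ∈ xs → length (filter P? xs) < length (filter Q? xs)
      go (x ∷ xs) (here refl) with P? x | Q? x
      ... | yes p | _     = contradiction p ¬Pu
      ... | no _  | yes _ = s≤s (le xs)
      ... | no _  | no ¬q = contradiction Qu ¬q
      go (x ∷ xs) (there i) with P? x | Q? x
      ... | yes _ | yes _ = s≤s (go xs i)
      ... | yes p | no ¬q = contradiction (P⇒Q p) ¬q
      ... | no _  | yes _ = m≤n⇒m≤1+n (go xs i)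
      ... | no _  | no _  = go xs i

  unburned-decreases : ∀ {v} S → v ∈ unburned (spread S) →
                       length (unburned (v ∷ spread S)) < length (unburned S)
  unburned-decreases {v} S v∈ =
    length-filter-< _ _
      (λ u∉ u∈S → u∉ (there (spread-extends S u∈S)))
      (λ v∈S → v∉ (spread-extends S v∈S))
      (λ v∉′ → v∉′ (here refl))
      vertices (∈-vertices v)
    where
    v∉ : v ∉ spread S
    v∉ = proj₂ (∈-filter⁻ _ {xs = vertices} v∈)

  rounds-stable : ∀ next n p S → length (unburned S) ≤ n →
                  rounds next (suc n) p S ≡ rounds next n p S
  rounds-stable next zero p S len≤ with unburned S
  ... | [] = refl
  rounds-stable next (suc n) p S len≤ with unburned S in eq
  ... | []     = refl
  ... | x ∷ xs = cong suc afterSpread-stable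
    where
    stable : ∀ {u} → u ∈ unburned (spread S) →
             rounds next (suc n) (next p) (u ∷ spread S) ≡ rounds next n (next p) (u ∷ spread S)
    stable {u} u∈ = rounds-stable next n _ _
      (s≤s⁻¹ (<-≤-trans
        (subst (λ l → length (unburned (u ∷ spread S)) < length l) eq (unburned-decreases S u∈))
        len≤))

    afterSpread-stable : afterSpread next (suc n) p (spread S) ≡ afterSpread next n p (spread S)
    afterSpread-stable with unburned (spread S) | stable
    ... | []     | _  = refl
    ... | v ∷ vs | st = cong₂ (best p) (st (here refl)) (map-cong-local (All.tabulate (st ∘ there)))

  unburned-initially : length (unburned []) ≤ order
  unburned-initially = subst (length (unburned []) ≤_) (length-tabulate _) (length-filter _ vertices)

  value : (Player → Player) → Player → ℕ
  value next p = rounds next order p []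

open Burning public using (value)

bg : Graph → ℕ
bg G = value G opponent burner

bg′ : Graph → ℕ
bg′ G = value G opponent staller

-- The burning number: the same process with a single minimizing agent making
-- every selection.
b : Graph → ℕ
b G = value G id burner

{-# OPTIONS --safe #-}

-- Burning C = G ∘ H for two rounds spreads the fire within G by distance two,
-- so that C is compared with the burning of G² at half speed.  Write A for the
-- burning set of G² and N for closed neighbourhoods in G.
--
-- Upper bounds: Burner plays an optimal sequence of G² inside the copy of G.
-- Whenever Burner is about to move, N[A] and all copies of H over A burn.  When
-- A is everything, so is the fire in C.
--
-- Lower bounds: let the G²-agent copy the projections of Burner's selections,
-- while Staller selects a vertex in the copy of H over some w ∉ A that has a
-- neighbour in A.  This does not help, as w burns in the next round anyway: after
-- Burner's moves the fire projects into A, and after Staller's moves into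
-- N[N[A]], its vertices in G even lying in N[A].  At the end the G²-agent may need
-- one more round, which accounts for the slack of 2.  If H has a second vertex,
-- Staller's selection cannot complete the copy over w, hence cannot end the game,
-- and the slack drops to 1.
module Submission where

open import Defs
open import Data.Empty using (⊥-elim)
open import Data.List using (List; []; _∷_; map; length)
open import Data.List.Extrema.Nat using (min; max; argmin-sel; argmax-sel; min≤v⁺; v≤max⁺)
import Data.List.Membership.DecPropositional as DecMembership
open import Data.List.Membership.Propositional using (_∈_; _∉_; find; lose)
open import Data.List.Membership.Propositional.Properties
  using (∈-filter⁺; ∈-filter⁻; ∈-map⁺; ∈-map⁻)
open import Data.List.Relation.Unary.Any using (here; there; any?)
open import Data.Nat using (ℕ; zero; suc; _+_; _*_; _≤_; z≤n; s≤s; s≤s⁻¹)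
open import Data.Nat.Properties
  using (≤-refl; ≤-reflexive; ≤-trans; <-≤-trans; <⇒≱; n<1+n; m≤n+m; +-comm; +-suc; *-suc;
         +-monoʳ-≤; +-monoʳ-<; +-monoˡ-≤; *-monoʳ-≤; module ≤-Reasoning)
open import Data.Product using (∃-syntax; _×_; _,_; proj₂)
open import Data.Sum using (_⊎_; inj₁; inj₂; [_,_]′)
open import Data.Unit using (tt)
open import Function using (_∘_; id; mk⇔)
open import Function.Bundles using (mk↔ₛ′)
open import Relation.Binary.PropositionalEquality
  using (_≡_; _≢_; refl; sym; trans; cong; subst)
open import Relation.Nullary using (¬_; yes; no)
open import Relation.Nullary.Decidable using (¬?; _⊎-dec_)
open import Relation.Nullary.Negation using (contradiction)

-- Optimal selections as extrema over lists.

module _ {A : Set} (f : A → ℕ) (v : A) (vs : List A) where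

  best-attained : ∀ p → ∃[ u ] u ∈ v ∷ vs × best p (f v) (map f vs) ≡ f u
  best-attained p = attained (selected p)
    where
    selected : ∀ p → best p (f v) (map f vs) ≡ f v ⊎ best p (f v) (map f vs) ∈ map f vs
    selected burner  = argmin-sel id (f v) (map f vs)
    selected staller = argmax-sel id (f v) (map f vs)

    attained : ∀ {x} → x ≡ f v ⊎ x ∈ map f vs → ∃[ u ] u ∈ v ∷ vs × x ≡ f u
    attained (inj₁ eq) = v , here refl , eq
    attained (inj₂ x∈) with ∈-map⁻ f x∈
    ... | u , u∈ , eq = u , there u∈ , eq

  min-map-≤ : ∀ {u} → u ∈ v ∷ vs → min (f v) (map f vs) ≤ f u
  min-map-≤ (here refl) = min≤v⁺ _ (map f vs) (inj₁ ≤-refl)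
  min-map-≤ (there u∈) = min≤v⁺ _ _ (inj₂ (lose (∈-map⁺ f u∈) ≤-refl))

  ≤-max-map : ∀ {u} → u ∈ v ∷ vs → f u ≤ max (f v) (map f vs)
  ≤-max-map (here refl) = v≤max⁺ _ (map f vs) (inj₁ ≤-refl)
  ≤-max-map (there u∈) = v≤max⁺ _ _ (inj₂ (lose (∈-map⁺ f u∈) ≤-refl))

-- Positions of a single game and bounds for one round.

module Play (G : Graph) where
  open Graph G
  open Burning G public
  open DecMembership _≟_ using (_∈?_)

  Full : List V → Set
  Full S = ∀ v → v ∈ S

  ∈-unburned⁺ : ∀ {v} S → v ∉ S → v ∈ unburned S
  ∈-unburned⁺ S v∉S = ∈-filter⁺ _ (∈-vertices _) v∉S

  ∈-unburned⁻ : ∀ {v} S → v ∈ unburned S → v ∉ S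
  ∈-unburned⁻ S v∈ = proj₂ (∈-filter⁻ (λ v → ¬? (v ∈? S)) {xs = vertices} v∈)

  unburned-[]⇒Full : ∀ S → unburned S ≡ [] → Full S
  unburned-[]⇒Full S eq v with v ∈? S
  ... | yes v∈S = v∈S
  ... | no  v∉S with () ← subst (v ∈_) eq (∈-unburned⁺ S v∉S)

  full? : ∀ S → Full S ⊎ ∃[ v ] v ∉ S
  full? S with unburned S in eq
  ... | []    = inj₁ (unburned-[]⇒Full S eq)
  ... | v ∷ _ = inj₂ (v , ∈-unburned⁻ S (subst (v ∈_) (sym eq) (here refl)))

  ∈-spread⁺ : ∀ {v w} S → w ∈ S → Adj v w → v ∈ spread S
  ∈-spread⁺ S w∈S a = ∈-filter⁺ _ (∈-vertices _) (inj₂ (lose w∈S a))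

  ∈-spread⁻ : ∀ {v} S → v ∈ spread S → v ∈ S ⊎ ∃[ w ] w ∈ S × Adj v w
  ∈-spread⁻ S v∈ with proj₂ (∈-filter⁻ (λ v → (v ∈? S) ⊎-dec any? (adj? v) S) {xs = vertices} v∈)
  ... | inj₁ v∈S = inj₁ v∈S
  ... | inj₂ any = inj₂ (find any)

  spread-mono : ∀ {S T} → (∀ {v} → v ∈ S → v ∈ T) → ∀ {v} → v ∈ spread S → v ∈ spread T
  spread-mono {S} {T} S⊆T v∈ with ∈-spread⁻ S v∈
  ... | inj₁ v∈S           = spread-extends T (S⊆T v∈S)
  ... | inj₂ (w , w∈S , a) = ∈-spread⁺ T (S⊆T w∈S) a

  ∉-spread-[] : ∀ {v} → v ∉ spread []
  ∉-spread-[] v∈ with ∈-spread⁻ [] v∈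
  ... | inj₁ ()
  ... | inj₂ (_ , () , _)

  exhausted⇒Full : ∀ S → length (unburned S) ≤ 0 → Full S
  exhausted⇒Full S len≤0 with unburned S in eq
  ... | [] = unburned-[]⇒Full S eq

  -- Keeps the cut-off adequate along a line of play: each round costs one unit of fuel and at least
  -- one unburned vertex.
  fuel-decreases : ∀ {v n} S → v ∉ spread S → length (unburned S) ≤ suc n →
                   length (unburned (v ∷ spread S)) ≤ n
  fuel-decreases S v∉ len≤ =
    s≤s⁻¹ (<-≤-trans (unburned-decreases S (∈-unburned⁺ (spread S) v∉)) len≤)

  module _ (next : Player → Player) where

    rounds-Full : ∀ n p S → Full S → rounds next n p S ≡ 0
    rounds-Full zero    p S full = refl
    rounds-Full (suc n) p S full with unburned S in eq
    ... | []    = refl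
    ... | v ∷ _ = contradiction (full v) (∈-unburned⁻ S (subst (v ∈_) (sym eq) (here refl)))

    rounds-suc : ∀ {v} n p S → v ∉ S →
                 rounds next (suc n) p S ≡ suc (afterSpread next n p (spread S))
    rounds-suc n p S v∉S with unburned S in eq
    ... | []    = contradiction (unburned-[]⇒Full S eq _) v∉S
    ... | _ ∷ _ = refl

    rounds-suc-≤ : ∀ n p S → rounds next (suc n) p S ≤ suc (afterSpread next n p (spread S))
    rounds-suc-≤ n p S with unburned S
    ... | []    = z≤n
    ... | _ ∷ _ = ≤-refl

    afterSpread-Full : ∀ n p S → Full S → afterSpread next n p S ≡ 0
    afterSpread-Full n p S full with unburned S in eq
    ... | []    = refl
    ... | v ∷ _ = contradiction (full v) (∈-unburned⁻ S (subst (v ∈_) (sym eq) (here refl)))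

    afterSpread-attained : ∀ {v} n p S → v ∉ S →
      ∃[ u ] u ∉ S × afterSpread next n p S ≡ rounds next n (next p) (u ∷ S)
    afterSpread-attained n p S v∉S with unburned S in eq
    ... | []     = contradiction (unburned-[]⇒Full S eq _) v∉S
    ... | v ∷ vs with best-attained (λ u → rounds next n (next p) (u ∷ S)) v vs p
    ...   | u , u∈ , e = u , ∈-unburned⁻ S (subst (u ∈_) (sym eq) u∈) , e

    afterSpread-burner-≤ : ∀ {v} n S → v ∉ S →
      afterSpread next n burner S ≤ rounds next n (next burner) (v ∷ S)
    afterSpread-burner-≤ n S v∉S with unburned S | ∈-unburned⁺ S v∉S
    ... | v ∷ vs | v∈ = min-map-≤ (λ u → rounds next n (next burner) (u ∷ S)) v vs v∈

    ≤-afterSpread-staller : ∀ {v} n S → v ∉ S →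
      rounds next n (next staller) (v ∷ S) ≤ afterSpread next n staller S
    ≤-afterSpread-staller n S v∉S with unburned S | ∈-unburned⁺ S v∉S
    ... | v ∷ vs | v∈ = ≤-max-map (λ u → rounds next n (next staller) (u ∷ S)) v vs v∈

    afterSpread-≤ : ∀ {t} n p S →
      (∀ {v} → v ∉ S → rounds next n (next p) (v ∷ S) ≤ t) → afterSpread next n p S ≤ t
    afterSpread-≤ {t} n p S h with full? S
    ... | inj₁ full = subst (_≤ t) (sym (afterSpread-Full n p S full)) z≤n
    ... | inj₂ (_ , v∉S) with afterSpread-attained n p S v∉S
    ...   | u , u∉S , e = subst (_≤ t) (sym e) (h u∉S)

    -- If `v` already burns, every selection leaves it burning. Burner can therefore aim at a vertex
    -- copied from another game without checking that it is still available.
    afterSpread-burner-≤-any : ∀ {t} n S v →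
      (∀ u → v ∈ u ∷ S → rounds next n (next burner) (u ∷ S) ≤ t) →
      afterSpread next n burner S ≤ t
    afterSpread-burner-≤-any n S v h with v ∈? S
    ... | yes v∈S = afterSpread-≤ n burner S (λ {u} _ → h u (there v∈S))
    ... | no  v∉S = ≤-trans (afterSpread-burner-≤ n S v∉S) (h v (here refl))

    rounds-≤1 : ∀ n p S → Full (spread S) → rounds next n p S ≤ 1
    rounds-≤1 zero    p S full = z≤n
    rounds-≤1 (suc n) p S full = ≤-trans (rounds-suc-≤ n p S)
      (s≤s (≤-reflexive (afterSpread-Full n p (spread S) full)))

    rounds-burner-≤ : ∀ {v} n S → v ∉ spread S →
      rounds next (suc n) burner S ≤ suc (rounds next n (next burner) (v ∷ spread S))
    rounds-burner-≤ n S v∉ =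
      ≤-trans (rounds-suc-≤ n burner S) (s≤s (afterSpread-burner-≤ n (spread S) v∉))

-- Edges leaving a set in a connected graph.

module _ {G : Graph} (conn : Connected G) where
  open Graph G
  open Connected conn
  open DecMembership _≟_ using (_∈?_)

  -- A walk from `u` to `w` has a first step out of `A`.
  boundary : ∀ {u w} (A : List V) → u ∈ A → w ∉ A → ∃[ x ] ∃[ y ] x ∈ A × y ∉ A × Adj x y
  boundary {u} {w} A u∈A w∉A = along u∈A (proj₂ (joined u w))
    where
    along : ∀ {k u} → u ∈ A → Walk k u w → ∃[ x ] ∃[ y ] x ∈ A × y ∉ A × Adj x y
    along u∈A nil = contradiction u∈A w∉A
    along u∈A (cons {v = v} a p) with v ∈? A
    ... | yes v∈A = along v∈A p
    ... | no  v∉A = _ , _ , u∈A , v∉A , a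

-- One spread in the square against two spreads in the graph.

module _ (G : Graph) where
  open Graph G
  private
    module PG = Play G
    module PS = Play (G ²)

  ∈-spread²⁺ : ∀ {u} A → u ∈ PG.spread (PG.spread A) → u ∈ PS.spread A
  ∈-spread²⁺ {u} A u∈ = [ once , twice ]′ (PG.∈-spread⁻ (PG.spread A) u∈)
    where
    near : ∀ {w l} → l ≤ 2 → Walk l u w → w ∈ A → u ∈ PS.spread A
    -- Adjacency in `G ²` excludes equality, so a closed walk is handled apart.
    near {w} l≤2 p w∈A with u ≟ w
    ... | yes refl = PS.spread-extends A w∈A
    ... | no  u≢w  = PS.∈-spread⁺ A w∈A (u≢w , _ , l≤2 , p)

    once : u ∈ PG.spread A → u ∈ PS.spread A
    once u∈ with PG.∈-spread⁻ A u∈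
    ... | inj₁ u∈A           = PS.spread-extends A u∈A
    ... | inj₂ (w , w∈A , a) = near (s≤s z≤n) (cons a nil) w∈A

    twice : ∃[ x ] x ∈ PG.spread A × Adj u x → u ∈ PS.spread A
    twice (x , x∈ , a) with PG.∈-spread⁻ A x∈
    ... | inj₁ x∈A           = near (s≤s z≤n) (cons a nil) x∈A
    ... | inj₂ (w , w∈A , c) = near ≤-refl (cons a (cons c nil)) w∈A

  ∈-spread²⁻ : ∀ {u} A → u ∈ PS.spread A → u ∈ PG.spread (PG.spread A)
  ∈-spread²⁻ A u∈ with PS.∈-spread⁻ A u∈
  ... | inj₁ u∈A = PG.spread-extends _ (PG.spread-extends A u∈A)
  ... | inj₂ (w , w∈A , _ , _ , _ , nil) = PG.spread-extends _ (PG.spread-extends A w∈A)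
  ... | inj₂ (w , w∈A , _ , _ , _ , cons a nil) = PG.spread-extends _ (PG.∈-spread⁺ A w∈A a)
  ... | inj₂ (w , w∈A , _ , _ , _ , cons a (cons c nil)) =
    PG.∈-spread⁺ _ (PG.∈-spread⁺ A w∈A c) a
  ... | inj₂ (w , w∈A , _ , _ , s≤s (s≤s ()) , cons _ (cons _ (cons _ _)))

-- The corona game: upper bounds.

module CoronaGame (G H : Graph) where
  private
    module G = Graph G
    module H = Graph H
    module PG = Play G
    module PS = Play (G ²)
    module PC = Play (corona G H)
  open DecMembership G._≟_ using (_∈?_)

  roundsC : ℕ → Player → List (CoronaV G H) → ℕ
  roundsC = PC.rounds opponent

  rounds² : ℕ → List G.V → ℕ
  rounds² m = PS.rounds id m burner

  base : CoronaV G H → G.V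
  base (inj₁ u)       = u
  base (inj₂ (u , _)) = u

  inj₁-spread : ∀ B {S} → (∀ {u} → u ∈ B → inj₁ u ∈ S) →
                ∀ {u} → u ∈ PG.spread B → inj₁ u ∈ PC.spread S
  inj₁-spread B {S} B⊆S u∈ with PG.∈-spread⁻ B u∈
  ... | inj₁ u∈B           = PC.spread-extends S (B⊆S u∈B)
  ... | inj₂ (w , w∈B , a) = PC.∈-spread⁺ S (B⊆S w∈B) a

  spread-base-Full : ∀ {S} → (∀ u → inj₁ u ∈ S) → PC.Full (PC.spread S)
  spread-base-Full {S} h (inj₁ u)       = PC.spread-extends S (h u)
  spread-base-Full {S} h (inj₂ (u , _)) = PC.∈-spread⁺ S (h u) refl

  -- Spreading once from `map inj₁ A` in the corona burns exactly `N[A]` in `G` and all copies of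
  -- `H` over `A`.
  Dominates : List G.V → List (CoronaV G H) → Set
  Dominates A S = ∀ {x} → x ∈ PC.spread (map inj₁ A) → x ∈ S

  Dominates-spread : ∀ A S → Dominates A S → ∀ {u} → u ∈ PS.spread A → inj₁ u ∈ PC.spread S
  Dominates-spread A S dom u∈ =
    inj₁-spread (PG.spread A) (λ v∈ → dom (inj₁-spread A (∈-map⁺ inj₁) v∈)) (∈-spread²⁻ G A u∈)

  Dominates-Full : ∀ {A} S → PS.Full A → Dominates A S → PC.Full S
  Dominates-Full S full dom x = dom (spread-base-Full (λ u → ∈-map⁺ inj₁ (full u)) x)

  -- The spread before Staller's selection already establishes dominance, and additional fire
  -- preserves it.
  staller-upper : ∀ {t} n A S → (∀ {u} → u ∈ A → inj₁ u ∈ S) →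
    (∀ n S → Dominates A S → roundsC n burner S ≤ t) → roundsC n staller S ≤ suc t
  staller-upper zero    A S A⊆S h = z≤n
  staller-upper (suc n) A S A⊆S h =
    ≤-trans (PC.rounds-suc-≤ opponent n staller S)
      (s≤s (PC.afterSpread-≤ opponent n staller (PC.spread S)
        (λ _ → h n _ (there ∘ PC.spread-mono A⊆S′))))
    where
    A⊆S′ : ∀ {x} → x ∈ map inj₁ A → x ∈ S
    A⊆S′ x∈ with ∈-map⁻ inj₁ x∈
    ... | u , u∈A , refl = A⊆S u∈A

  burner-upper : ∀ {t} n A S v → Dominates A S →
    (∀ n S → Dominates (v ∷ PS.spread A) S → roundsC n burner S ≤ t) →
    roundsC n burner S ≤ suc (suc t)
  burner-upper zero A S v dom h = z≤n
  burner-upper (suc n) A S v dom h =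
    ≤-trans (PC.rounds-suc-≤ opponent n burner S)
      (s≤s (PC.afterSpread-burner-≤-any opponent n (PC.spread S) (inj₁ v)
        (λ x v∈ → staller-upper n (v ∷ PS.spread A) _
          (λ { (here refl) → v∈ ; (there u∈) → there (Dominates-spread A S dom u∈) }) h)))

  -- The fuel `n` may be arbitrary, as a cut-off in the corona only lowers the left side; `m` must
  -- suffice, so that `m` = 0 forces `A` to be everything.
  upper : ∀ m n A S → length (PS.unburned A) ≤ m → Dominates A S →
          roundsC n burner S ≤ 2 * rounds² m A
  upper zero n A S len dom =
    ≤-reflexive (PC.rounds-Full opponent n burner S
      (Dominates-Full S (PS.exhausted⇒Full A len) dom))
  upper (suc m) n A S len dom with PS.full? A
  ... | inj₁ full = ≤-trans
    (≤-reflexive (PC.rounds-Full opponent n burner S (Dominates-Full S full dom))) z≤n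
  ... | inj₂ (w , w∉A) with PS.full? (PS.spread A)
  -- `G ²` finishes by spreading alone, in one round, which allows two rounds in the corona. The
  -- target `w` is a mere placeholder.
  ...   | inj₁ full rewrite PS.rounds-suc id m burner A w∉A
                          | PS.afterSpread-Full id m burner (PS.spread A) full =
    burner-upper n A S w dom
      (λ n T domT → ≤-reflexive (PC.rounds-Full opponent n burner T
        (Dominates-Full T (there ∘ full) domT)))
  ...   | inj₂ (_ , u∉) with PS.afterSpread-attained id m burner (PS.spread A) u∉
  ...     | v , v∉ , e rewrite PS.rounds-suc id m burner A w∉A | e
                             | *-suc 2 (rounds² m (v ∷ PS.spread A)) =
    burner-upper n A S v dom (λ n T → upper m n _ T (PS.fuel-decreases A v∉ len))

  bg-upper : bg (corona G H) ≤ 2 * b (G ²)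
  bg-upper = upper _ (Graph.order (corona G H)) [] [] PS.unburned-initially (⊥-elim ∘ PC.∉-spread-[])

  bg′-upper : bg′ (corona G H) ≤ 2 * b (G ²) + 1
  bg′-upper rewrite +-comm (2 * b (G ²)) 1 =
    staller-upper (Graph.order (corona G H)) [] [] (λ ())
      (λ n S → upper _ n [] S PS.unburned-initially)

  -- Lower bounds: invariants and Staller's strategy.

  Projects : List G.V → List (CoronaV G H) → Set
  Projects A S = ∀ {x} → x ∈ S → base x ∈ A

  record Confined (A : List G.V) (S : List (CoronaV G H)) : Set where
    field
      core   : ∀ {u} → inj₁ u ∈ S → u ∈ PG.spread A
      copies : ∀ {u h} → inj₂ (u , h) ∈ S → u ∈ PS.spread A

  open Confined

  spread⊆spread² : ∀ {u} A → u ∈ PG.spread A → u ∈ PS.spread A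
  spread⊆spread² A u∈ = ∈-spread²⁺ G A (PG.spread-extends (PG.spread A) u∈)

  -- Fire in `N[A]` moves at most to `N[N[A]]`, the spread in `G ²`. Fire in a copy leaves it only
  -- for its own base vertex, so copies may burn over all of `N[N[A]]`.
  Confined-spread : ∀ {A S} → Confined A S → Projects (PS.spread A) (PC.spread S)
  Confined-spread {A} {S} conf {x} x∈ with x | PC.∈-spread⁻ S x∈
  ... | inj₁ u       | inj₁ x∈S = spread⊆spread² A (core conf x∈S)
  ... | inj₂ (u , h) | inj₁ x∈S = copies conf x∈S
  ... | inj₁ u       | inj₂ (inj₁ v , v∈S , a) =
    ∈-spread²⁺ G A (PG.∈-spread⁺ (PG.spread A) (core conf v∈S) a)
  ... | inj₁ u       | inj₂ (inj₂ (.u , _) , v∈S , refl) = copies conf v∈S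
  ... | inj₂ (u , _) | inj₂ (inj₁ .u , v∈S , refl) = spread⊆spread² A (core conf v∈S)
  ... | inj₂ (u , _) | inj₂ (inj₂ (.u , _) , v∈S , refl , _) = copies conf v∈S

  Projects-spread-core : ∀ {A S u} → Projects A S → inj₁ u ∈ PC.spread S → u ∈ PG.spread A
  Projects-spread-core {A} {S} proj u∈ with PC.∈-spread⁻ S u∈
  ... | inj₁ u∈S = PG.spread-extends A (proj u∈S)
  ... | inj₂ (inj₁ _ , v∈S , a)    = PG.∈-spread⁺ A (proj v∈S) a
  ... | inj₂ (inj₂ _ , v∈S , refl) = PG.spread-extends A (proj v∈S)

  -- All neighbours of a vertex in a copy project to the same base vertex as it does.
  Projects-spread-copies : ∀ {A S u h} → Projects A S → inj₂ (u , h) ∈ PC.spread S → u ∈ A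
  Projects-spread-copies {A} {S} proj u∈ with PC.∈-spread⁻ S u∈
  ... | inj₁ u∈S = proj u∈S
  ... | inj₂ (inj₁ _ , v∈S , refl)     = proj v∈S
  ... | inj₂ (inj₂ _ , v∈S , refl , _) = proj v∈S

  -- c = 1 is always possible; c = 0 when H has a second vertex.
  module Lower (conn : Connected G) (h₀ : H.V) (c : ℕ) (trivial⇒1≤c : (∀ h → h ≡ h₀) → 1 ≤ c) where

    -- The slack is `suc c` before Burner's moves and `c` before Staller's. Now `n` must suffice for
    -- the corona, while a cut-off at `m` only lowers the left side.
    burner-lower : ∀ n m A S → length (PC.unburned S) ≤ n → Confined A S →
                   (PC.Full S → 1 ≤ c) → 2 * rounds² m A ≤ roundsC n burner S + suc c
    staller-lower : ∀ n m A S {v} → length (PC.unburned S) ≤ n → Projects A S → v ∈ A →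
                    2 * rounds² m A ≤ roundsC n staller S + c

    burner-lower n zero A S len conf f = z≤n
    burner-lower n (suc m) A S len conf f with PC.full? S
    -- The corona is finished, but `A` may need one more spread. The resulting 2 is at most `suc c`,
    -- since fullness forces `c` to be at least 1.
    ... | inj₁ full =
      ≤-trans (*-monoʳ-≤ 2 (PS.rounds-≤1 id (suc m) burner A
                (λ u → Confined-spread conf (PC.spread-extends S (full (inj₁ u))))))
        (≤-trans (s≤s (f full)) (m≤n+m (suc c) _))
    burner-lower zero (suc m) A S len conf f | inj₂ (x , x∉S) =
      contradiction (PC.exhausted⇒Full S len x) x∉S
    burner-lower (suc n) (suc m) A S len conf f | inj₂ (x , x∉S)
      rewrite PC.rounds-suc opponent n burner S x∉S with PS.full? (PS.spread A)
    -- The 2 on the left is covered by the current corona round and the `suc` in the slack.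
    ... | inj₁ full = ≤-trans (*-monoʳ-≤ 2 (PS.rounds-≤1 id (suc m) burner A full))
                        (s≤s (≤-trans (s≤s z≤n) (m≤n+m (suc c) _)))
    ... | inj₂ (u , u∉) with PC.afterSpread-attained opponent {inj₁ u} n burner (PC.spread S)
                               (u∉ ∘ Confined-spread conf)
    ...   | y , y∉ , e rewrite e = reply
      where
      follow : ∀ v → v ∉ PS.spread A → base y ∈ v ∷ PS.spread A →
               2 * rounds² (suc m) A ≤ suc (roundsC n staller (y ∷ PC.spread S) + suc c)
      follow v v∉ y∈ = begin
        2 * rounds² (suc m) A
          ≤⟨ *-monoʳ-≤ 2 (PS.rounds-burner-≤ id m A v∉) ⟩
        2 * suc (rounds² m (v ∷ PS.spread A))
          ≡⟨ *-suc 2 _ ⟩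
        2 + 2 * rounds² m (v ∷ PS.spread A)
          ≤⟨ +-monoʳ-≤ 2 (staller-lower n m (v ∷ PS.spread A) (y ∷ PC.spread S)
               (PC.fuel-decreases S y∉ len)
               (λ { (here refl) → y∈ ; (there z∈) → there (Confined-spread conf z∈) })
               (here refl)) ⟩
        2 + (roundsC n staller (y ∷ PC.spread S) + c)
          -- One of the two units is Burner's round; the other raises the slack from `c` to `suc c`.
          ≡⟨ cong suc (sym (+-suc _ c)) ⟩
        suc (roundsC n staller (y ∷ PC.spread S) + suc c) ∎
        where open ≤-Reasoning

      reply : 2 * rounds² (suc m) A ≤ suc (roundsC n staller (y ∷ PC.spread S) + suc c)
      reply with base y ∈? PS.spread A
      -- Burner's selection projects to a vertex burning in `G ²`, so the agent takes the unburned
      -- `u` instead.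
      ... | yes y∈ = follow u u∉ (there y∈)
      ... | no  y∉ = follow (base y) y∉ (here refl)

    staller-lower n m A S len proj v∈A with PS.full? A
    ... | inj₁ full rewrite PS.rounds-Full id m burner A full = z≤n
    -- Here `v∈A` and connectedness yield the boundary edge whose outer end carries Staller's
    -- selection.
    ... | inj₂ (_ , u∉A) with boundary conn A v∈A u∉A
    staller-lower zero m A S len proj v∈A | inj₂ _ | _ , w , _ , w∉A , _ =
      contradiction (proj (PC.exhausted⇒Full S len (inj₁ w))) w∉A
    staller-lower (suc n) m A S len proj v∈A | inj₂ _ | z , w , z∈A , w∉A , a = begin
        2 * rounds² m A
          ≤⟨ burner-lower n m A (leaf ∷ PC.spread S) (PC.fuel-decreases S leaf∉ len) conf
               (λ full → trivial⇒1≤c (sole full)) ⟩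
        roundsC n burner (leaf ∷ PC.spread S) + suc c
          ≡⟨ +-suc _ c ⟩
        suc (roundsC n burner (leaf ∷ PC.spread S) + c)
          ≤⟨ s≤s (+-monoˡ-≤ c (PC.≤-afterSpread-staller opponent n (PC.spread S) leaf∉)) ⟩
        suc (PC.afterSpread opponent n staller (PC.spread S)) + c
          ≡⟨ cong (_+ c) (sym (PC.rounds-suc opponent {inj₁ w} n staller S (w∉A ∘ proj))) ⟩
        roundsC (suc n) staller S + c ∎
      where
      open ≤-Reasoning

      leaf : CoronaV G H
      leaf = inj₂ (w , h₀)

      leaf∉ : leaf ∉ PC.spread S
      leaf∉ = w∉A ∘ Projects-spread-copies proj

      conf : Confined A (leaf ∷ PC.spread S)
      conf .core (there u∈) = Projects-spread-core proj u∈
      conf .copies (here refl) =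
        ∈-spread²⁺ G A (PG.spread-extends (PG.spread A) (PG.∈-spread⁺ A z∈A (G.symm a)))
      conf .copies (there u∈) = PS.spread-extends A (Projects-spread-copies proj u∈)

      -- As `w` is outside `A`, no other vertex of its copy burns yet.
      sole : PC.Full (leaf ∷ PC.spread S) → ∀ h → h ≡ h₀
      sole full h with full (inj₂ (w , h))
      ... | here refl = refl
      ... | there h∈  = contradiction (Projects-spread-copies proj h∈) w∉A

    nonempty : G.V
    nonempty = Connected.nonempty conn

    bg-lower : 2 * b (G ²) ≤ bg (corona G H) + suc c
    bg-lower = burner-lower _ G.order [] [] PC.unburned-initially
      (record { core = λ () ; copies = λ () }) (λ full → contradiction (full (inj₁ nonempty)) λ ())

    -- With `A` empty there is no boundary edge, so Staller opens over an arbitrary vertex and the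
    -- agent selects that vertex. A whole `G ²` round is set against a single corona round, which
    -- adds 1 to the slack.
    staller-first : ∀ n m → length (PC.unburned []) ≤ n →
                    2 * rounds² m [] ≤ roundsC n staller [] + suc (suc c)
    staller-first n zero len = z≤n
    staller-first zero (suc m) len =
      contradiction (PC.exhausted⇒Full [] len (inj₁ nonempty)) λ ()
    staller-first (suc n) (suc m) len = begin
        2 * rounds² (suc m) []
          ≤⟨ *-monoʳ-≤ 2 (PS.rounds-burner-≤ id m [] u∉) ⟩
        2 * suc (rounds² m (u ∷ PS.spread []))
          ≡⟨ *-suc 2 _ ⟩
        2 + 2 * rounds² m (u ∷ PS.spread [])
          ≤⟨ +-monoʳ-≤ 2 (burner-lower n m _ (leaf ∷ PC.spread []) (PC.fuel-decreases [] leaf∉ len) conf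
               (λ full → ⊥-elim (core∉ (full (inj₁ u))))) ⟩
        2 + (roundsC n burner (leaf ∷ PC.spread []) + suc c)
          ≡⟨ cong suc (sym (+-suc _ (suc c))) ⟩
        suc (roundsC n burner (leaf ∷ PC.spread [])) + suc (suc c)
          ≤⟨ s≤s (+-monoˡ-≤ _ (PC.≤-afterSpread-staller opponent n (PC.spread []) leaf∉)) ⟩
        suc (PC.afterSpread opponent n staller (PC.spread [])) + suc (suc c)
          ≡⟨ cong (_+ suc (suc c)) (sym (PC.rounds-suc opponent {inj₁ u} n staller [] λ ())) ⟩
        roundsC (suc n) staller [] + suc (suc c) ∎
      where
      open ≤-Reasoning

      u : G.V
      u = nonempty

      leaf : CoronaV G H
      leaf = inj₂ (u , h₀)

      u∉ : u ∉ PS.spread []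
      u∉ = PS.∉-spread-[]

      leaf∉ : leaf ∉ PC.spread []
      leaf∉ = PC.∉-spread-[]

      core∉ : ∀ {x} → inj₁ x ∉ leaf ∷ PC.spread []
      core∉ (there x∈) = PC.∉-spread-[] x∈

      conf : Confined (u ∷ PS.spread []) (leaf ∷ PC.spread [])
      conf .core x∈ = ⊥-elim (core∉ x∈)
      conf .copies (here refl) = PS.spread-extends _ (here refl)
      conf .copies (there x∈) = ⊥-elim (PC.∉-spread-[] x∈)

    bg′-lower : 2 * b (G ²) ≤ bg′ (corona G H) + suc (suc c)
    bg′-lower = staller-first _ G.order PC.unburned-initially

-- One-vertex graphs and the final bounds.

sole⇒≅K₁ : ∀ {H} (h₀ : Graph.V H) → (∀ h → h ≡ h₀) → H ≅ K₁
sole⇒≅K₁ {H} h₀ sole = record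
  { bijection = mk↔ₛ′ (λ _ → tt) (λ _ → h₀) (λ _ → refl) (sym ∘ sole)
  ; adjacency = λ u v → mk⇔ (Graph.irrefl H (trans (sole u) (sym (sole v)))) ⊥-elim
  }

theorem21 : (G H : Graph) → Connected G → Connected H →
    (2 * b (G ²) ≤ bg (corona G H) + 2 × bg (corona G H) ≤ 2 * b (G ²)) ×
    (¬ (H ≅ K₁) → bg (corona G H) + 2 ≢ 2 * b (G ²)) ×
    (2 * b (G ²) ≤ bg′ (corona G H) + 3 × bg′ (corona G H) ≤ 2 * b (G ²) + 1) ×
    (¬ (H ≅ K₁) → bg′ (corona G H) + 3 ≢ 2 * b (G ²))
theorem21 G H connG connH =
  (General.bg-lower , bg-upper) ,
  (λ H≇K₁ e → strict (bg (corona G H)) e (Nontrivial.bg-lower H≇K₁)) ,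
  (General.bg′-lower , bg′-upper) ,
  (λ H≇K₁ e → strict (bg′ (corona G H)) e (Nontrivial.bg′-lower H≇K₁))
  where
  open CoronaGame G H
  h₀ = Connected.nonempty connH
  -- Taking `c` = 1 gives the slacks 2 and 3; `c` = 0 gives 1 and 2, which rules out equality.
  module General = Lower connG h₀ 1 (λ _ → ≤-refl)
  module Nontrivial (H≇K₁ : ¬ (H ≅ K₁)) =
    Lower connG h₀ 0 (λ sole → contradiction (sole⇒≅K₁ h₀ sole) H≇K₁)

  strict : ∀ n {k t} → n + suc k ≡ t → ¬ (t ≤ n + k)
  strict n e t≤ = <⇒≱ (+-monoʳ-< n (n<1+n _)) (subst (_≤ _) (sym e) t≤)
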